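{- Let $(X,\mu)$ be a computable probability space and $n\ge 1$. If $x\in X$ is weakly $n$-random, then for any $\Sigma^0_n$ set $A$ (not necessarily containing $x$) with $\mu(A)>0$ and any computable ergodic measure-preserving transformation $T:\subseteq X\to X$ with $x\in\operatorname{dom}T$, we have $T^k(x)\in A$ for some $k>0$.
   Context: Uniformity: a sequence of objects has a property (whose definition involves an index in $\mathbb N$) uniformly if a computable function produces suitable indices. A computable metric space is a triple $(X,d,S)$ where $(X,d)$ is a complete separable metric space, $S=(s_i)_i$ is a dense sequence in $X$, and $d(s_i,s_j)$ is a computable real number uniformly in $i,j$. With $(q_j)_j$ a fixed enumeration of the positive rationals and $\langle\cdot,\cdot\rangle$ the standard pairing function, the ideal balls are $B_{\langle i,j\rangle}=\{x\in X: d(x,s_i)<q_j\}$. A set $U\subseteq X$ is $\Sigma^0_1$ if $U=\bigcup_{i\in W}B_i$ for some c.e. $W\subseteq\mathbb N$ (its index is an index of $W$). A set is $\Pi^0_n$ if its complement is $\Sigma^0_n$. A set is $\Sigma^0_{n+1}$ if it equals $\bigcup_{i\in W}(X\setminus U^n_i)$ for some c.e. $W\subseteq\mathbb N$, where $U^n_i$ is the $i$-th $\Sigma^0_n$ set. For $D\subseteq X$, a subset of $D$ is $\Sigma^0_n$ in $D$ if it is the intersection of $D$ with a $\Sigma^0_n$ subset of $X$. A computable probability space $(X,\mu)$ is a computable metric space with a Borel probability measure $\mu$ such that $\mu(\bigcup_{i\in F}B_i)$ is lower-semicomputable uniformly in finite $F\subseteq\mathbb N$. A point is weakly $n$-random if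 it lies in no $\mu$-null $\Pi^0_n$ set. A measure-preserving transformation is a partial Borel measurable map $T:\subseteq X\to X$ such that $\mu(T^{ -1}(B))=\mu(B)$ for every Borel $B$ (so $\operatorname{dom}T$ has full measure) and $x\in\operatorname{dom}T$ implies $T(x)\in\operatorname{dom}T$. It is computable if the sets $T^{ -1}(B_i)$ are uniformly $\Sigma^0_1$ in $\operatorname{dom}T$. It is ergodic if every Borel $B$ with $T^{ -1}(B)=B$ has measure $0$ or $1$. -}

module Defs where

open import Level using (Level; 0ℓ; _⊔_) renaming (suc to lsuc)
open import Data.Integer.Base using (+_; _⊖_)
open import Data.List.Base using (List; []; _∷_)
open import Data.List.Membership.Propositional using () renaming (_∈_ to _∈ˡ_)
open import Data.Nat.Base as ℕ using (ℕ; zero; suc; NonZero)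
open import Data.Product.Base using (Σ; ∃; ∃₂; ∃-syntax; _×_; _,_; proj₁; proj₂; uncurry)
open import Data.Rational.Base as ℚ using (ℚ; 0ℚ; 1ℚ; ½)
import Data.Rational.Properties as ℚₚ
open import Data.Sum.Base using (_⊎_)
open import Function.Base using (id; _∘_)
open import Relation.Binary.Bundles using (Setoid)
open import Relation.Binary.PropositionalEquality
  using (_≡_; _≢_; refl; sym; trans; cong; subst; module ≡-Reasoning)
open import Relation.Nullary.Negation using (¬_)
open import Relation.Unary using (Pred; _∈_; _∉_; _⊆_; _≐_; _∩_; _⊥_; ∁; U)

------------------------------------------------------------------------
-- Pairing (Cantor)

triangular : ℕ → ℕ
triangular zero    = 0
triangular (suc n) = suc n ℕ.+ triangular n

⟨_,_⟩ : ℕ → ℕ → ℕ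
⟨ x , y ⟩ = triangular (x ℕ.+ y) ℕ.+ y

-- The inverse walks along the antidiagonals (0,0), (1,0), (0,1), (2,0), …
next : ℕ × ℕ → ℕ × ℕ
next (zero  , y) = suc y , 0
next (suc x , y) = x , suc y

unpair : ℕ → ℕ × ℕ
unpair zero    = 0 , 0
unpair (suc n) = next (unpair n)

π₁ π₂ : ℕ → ℕ
π₁ = proj₁ ∘ unpair
π₂ = proj₂ ∘ unpair

codeList : List ℕ → ℕ
codeList []       = 0
codeList (i ∷ is) = suc ⟨ i , codeList is ⟩

------------------------------------------------------------------------
-- Partial recursive functions

-- Unary μ-recursive functions, with several arguments packed by ⟨_,_⟩.
-- The last scheme `univ`, which applies the function with index π₁ n to
-- π₂ n, is Kleene's enumeration scheme S9.  By the enumeration theorem it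
-- does not enlarge the class of functions.
data Code : Set where
  zer suc′ left right : Code
  pair comp prec      : Code → Code → Code
  mu                  : Code → Code
  univ                : Code

encode : Code → ℕ
encode zer        = ⟨ 0 , 0 ⟩
encode suc′       = ⟨ 1 , 0 ⟩
encode left       = ⟨ 2 , 0 ⟩
encode right      = ⟨ 3 , 0 ⟩
encode (pair f g) = ⟨ 4 , ⟨ encode f , encode g ⟩ ⟩
encode (comp f g) = ⟨ 5 , ⟨ encode f , encode g ⟩ ⟩
encode (prec f g) = ⟨ 6 , ⟨ encode f , encode g ⟩ ⟩
encode (mu f)     = ⟨ 7 , encode f ⟩
encode univ       = ⟨ 8 , 0 ⟩

infix 4 _[_]⇓_ _∙_⇓_

data _[_]⇓_ : Code → ℕ → ℕ → Set where
  zer⇓   : ∀ {n} → zer [ n ]⇓ 0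
  suc⇓   : ∀ {n} → suc′ [ n ]⇓ suc n
  left⇓  : ∀ {n} → left [ n ]⇓ π₁ n
  right⇓ : ∀ {n} → right [ n ]⇓ π₂ n
  pair⇓  : ∀ {f g n a b} → f [ n ]⇓ a → g [ n ]⇓ b → pair f g [ n ]⇓ ⟨ a , b ⟩
  comp⇓  : ∀ {f g n a b} → g [ n ]⇓ a → f [ a ]⇓ b → comp f g [ n ]⇓ b
  prec⇓₀ : ∀ {f g n a} → π₂ n ≡ 0 → f [ π₁ n ]⇓ a → prec f g [ n ]⇓ a
  prec⇓ₛ : ∀ {f g n k a b} → π₂ n ≡ suc k →
           prec f g [ ⟨ π₁ n , k ⟩ ]⇓ a →
           g [ ⟨ π₁ n , ⟨ k , a ⟩ ⟩ ]⇓ b →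
           prec f g [ n ]⇓ b
  mu⇓    : ∀ {f n k} → f [ ⟨ n , k ⟩ ]⇓ 0 →
           (∀ j → j ℕ.< k → ∃[ a ] f [ ⟨ n , j ⟩ ]⇓ suc a) →
           mu f [ n ]⇓ k
  univ⇓  : ∀ {c n a} → encode c ≡ π₁ n → c [ π₂ n ]⇓ a → univ [ n ]⇓ a

-- φ_e(x) = y; if e is not the number of a code, φ_e is nowhere defined.
_∙_⇓_ : ℕ → ℕ → ℕ → Set
e ∙ x ⇓ y = ∃[ c ] encode c ≡ e × c [ x ]⇓ y

Computable : (ℕ → ℕ) → Set
Computable f = ∃[ e ] (∀ x → e ∙ x ⇓ f x)

-- The e-th computably enumerable set, as the set enumerated by φ_e (its
-- range).
W : ℕ → Pred ℕ 0ℓ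
W e y = ∃[ x ] e ∙ x ⇓ y

-- `P i e` reads "e is an index witnessing the property of the i-th object";
-- the objects are named by natural numbers through `code`.
UniformlyIn : ∀ {a p} {I : Set a} → (I → ℕ) → (I → ℕ → Set p) → Set (a ⊔ p)
UniformlyIn code P = ∃[ f ] Computable f × (∀ i → P i (f (code i)))

------------------------------------------------------------------------
-- Real numbers

-- Dedekind cuts, given by their lower set { q | q < x }.  As usual in
-- classical mathematics the lower set determines the cut; the definitions
-- below are meant to be used in the presence of excluded middle.
record ℝ : Set₁ where
  field
    Lower     : Pred ℚ 0ℓ
    inhabited : ∃ Lower
    bounded   : ∃[ q ] ¬ Lower q
    downward  : ∀ {p q} → p ℚ.≤ q → Lower q → Lower p
    rounded   : ∀ {p} → Lower p → ∃[ q ] p ℚ.< q × Lower q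

open ℝ public using (Lower)

infix 4 _≤ʳ_ _<ʳ_ _≈ʳ_
infixl 6 _+ʳ_

_≤ʳ_ _<ʳ_ _≈ʳ_ : ℝ → ℝ → Set
x ≤ʳ y = Lower x ⊆ Lower y
x <ʳ y = ∃[ q ] ¬ Lower x q × Lower y q
x ≈ʳ y = x ≤ʳ y × y ≤ʳ x

p-1<p : ∀ p → p ℚ.- 1ℚ ℚ.< p
p-1<p p = subst (p ℚ.- 1ℚ ℚ.<_) (ℚₚ.+-identityʳ p)
  (ℚₚ.+-monoʳ-< p (ℚₚ.negative⁻¹ (ℚ.- 1ℚ)))

p+[q-p]≡q : ∀ p q → p ℚ.+ (q ℚ.- p) ≡ q
p+[q-p]≡q p q = begin
  p ℚ.+ (q ℚ.- p)     ≡⟨ cong (p ℚ.+_) (ℚₚ.+-comm q (ℚ.- p)) ⟩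
  p ℚ.+ (ℚ.- p ℚ.+ q) ≡⟨ ℚₚ.+-assoc p (ℚ.- p) q ⟨
  (p ℚ.- p) ℚ.+ q     ≡⟨ cong (ℚ._+ q) (ℚₚ.+-inverseʳ p) ⟩
  0ℚ ℚ.+ q            ≡⟨ ℚₚ.+-identityˡ q ⟩
  q                   ∎
  where open ≡-Reasoning

below : ∀ (x : ℝ) {p q} → Lower x p → ¬ Lower x q → p ℚ.< q
below x p∈x q∉x = ℚₚ.≰⇒> λ q≤p → q∉x (ℝ.downward x q≤p p∈x)

fromℚ : ℚ → ℝ
fromℚ q = record
  { Lower     = ℚ._< q
  ; inhabited = q ℚ.- 1ℚ , p-1<p q
  ; bounded   = q , ℚₚ.<-irrefl refl
  ; downward  = ℚₚ.≤-<-trans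
  ; rounded   = ℚₚ.<-dense
  }

0ʳ 1ʳ : ℝ
0ʳ = fromℚ 0ℚ
1ʳ = fromℚ 1ℚ

_+ʳ_ : ℝ → ℝ → ℝ
x +ʳ y = record
  { Lower     = Sum
  ; inhabited = let (a , a∈) = ℝ.inhabited x ; (b , b∈) = ℝ.inhabited y
                in a ℚ.+ b , a , b , a∈ , b∈ , refl
  ; bounded   = let (a , a∉) = ℝ.bounded x ; (b , b∉) = ℝ.bounded y
                in a ℚ.+ b , λ (c , d , c∈ , d∈ , eq) →
                     ℚₚ.<-irrefl (sym eq) (ℚₚ.+-mono-< (below x c∈ a∉) (below y d∈ b∉))
  ; downward  = λ {p} → λ { p≤q (a , b , a∈ , b∈ , refl) →
                  a , p ℚ.- a , a∈ ,
                  ℝ.downward y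
                    (subst (p ℚ.- a ℚ.≤_) (cancel a b) (ℚₚ.+-monoˡ-≤ (ℚ.- a) p≤q)) b∈ ,
                  sym (p+[q-p]≡q a p) }
  ; rounded   = λ { (a , b , a∈ , b∈ , refl) →
                  let (a′ , a<a′ , a′∈) = ℝ.rounded x a∈
                  in a′ ℚ.+ b , ℚₚ.+-monoˡ-< b a<a′ , a′ , b , a′∈ , b∈ , refl }
  }
  where
  Sum : Pred ℚ 0ℓ
  Sum q = ∃₂ λ a b → Lower x a × Lower y b × q ≡ a ℚ.+ b

  cancel : ∀ a b → (a ℚ.+ b) ℚ.- a ≡ b
  cancel a b = begin
    (a ℚ.+ b) ℚ.- a   ≡⟨ ℚₚ.+-assoc a b (ℚ.- a) ⟩
    a ℚ.+ (b ℚ.- a)   ≡⟨ p+[q-p]≡q a b ⟩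
    b                 ∎
    where open ≡-Reasoning

-- |x - y| < ε
Within : ℚ → ℝ → ℝ → Set
Within ε x y = x <ʳ y +ʳ fromℚ ε × y <ʳ x +ʳ fromℚ ε

sumʳ : (ℕ → ℝ) → ℕ → ℝ
sumʳ u zero    = 0ʳ
sumʳ u (suc n) = sumʳ u n +ʳ u n

-- The series Σ u converges to s.
HasSum : (ℕ → ℝ) → ℝ → Set
HasSum u s = ∀ ε → 0ℚ ℚ.< ε → ∃[ N ] ∀ n → N ℕ.≤ n → Within ε (sumʳ u n) s

------------------------------------------------------------------------
-- Computability of real numbers

rational : ℕ → ℚ
rational m = (π₁ (π₁ m) ⊖ π₂ (π₁ m)) ℚ./ suc (π₂ m)

positiveRational : ℕ → ℚ
positiveRational j = (+ suc (π₁ j)) ℚ./ suc (π₂ j)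

½^ : ℕ → ℚ
½^ zero    = 1ℚ
½^ (suc k) = ½ ℚ.* ½^ k

ComputableReal : ℝ → ℕ → Set
ComputableReal x e = ∀ k → ∃[ m ] e ∙ k ⇓ m × Within (½^ k) x (fromℚ (rational m))

LowerSemicomputable : ℝ → ℕ → Set
LowerSemicomputable x e = (λ m → fromℚ (rational m) <ʳ x) ≐ W e

------------------------------------------------------------------------
-- Computable metric spaces

-- Equality of points is the equality of the setoid.
record ComputableMetricSpace c ℓ : Set (lsuc (c ⊔ ℓ ⊔ lsuc 0ℓ)) where
  field
    setoid : Setoid c ℓ

  open Setoid setoid public using (_≈_) renaming (Carrier to X)

  field
    d            : X → X → ℝ
    d-nonNeg     : ∀ x y → 0ʳ ≤ʳ d x y
    d≈0⇒≈        : ∀ {x y} → d x y ≈ʳ 0ʳ → x ≈ y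
    ≈⇒d≈0        : ∀ {x y} → x ≈ y → d x y ≈ʳ 0ʳ
    d-sym        : ∀ x y → d x y ≈ʳ d y x
    d-triangle   : ∀ x y z → d x z ≤ʳ d x y +ʳ d y z

  Cauchy : (ℕ → X) → Set
  Cauchy u = ∀ ε → 0ℚ ℚ.< ε →
    ∃[ N ] ∀ m n → N ℕ.≤ m → N ℕ.≤ n → d (u m) (u n) <ʳ fromℚ ε

  ConvergesTo : (ℕ → X) → X → Set
  ConvergesTo u x = ∀ ε → 0ℚ ℚ.< ε → ∃[ N ] ∀ n → N ℕ.≤ n → d (u n) x <ʳ fromℚ ε

  field
    complete     : ∀ u → Cauchy u → ∃[ x ] ConvergesTo u x
    s            : ℕ → X
    s-dense      : ∀ x ε → 0ℚ ℚ.< ε → ∃[ i ] d x (s i) <ʳ fromℚ ε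
    d-computable : UniformlyIn (uncurry ⟨_,_⟩) (λ (i , j) → ComputableReal (d (s i) (s j)))

  ball : X → ℚ → Pred X 0ℓ
  ball x r y = d y x <ʳ fromℚ r

  -- The union of the A i with i ∈ I.
  ⋃[_] : Pred ℕ 0ℓ → (ℕ → Pred X 0ℓ) → Pred X 0ℓ
  ⋃[ I ] A x = ∃[ i ] i ∈ I × x ∈ A i

  B : ℕ → Pred X 0ℓ
  B n = ball (s (π₁ n)) (positiveRational (π₂ n))

  -- The i-th Σ⁰ₙ set.
  Σ⁰ : (n : ℕ) .{{_ : NonZero n}} → ℕ → Pred X 0ℓ
  Σ⁰ 1             i = ⋃[ W i ] B
  Σ⁰ (suc (suc n)) i = ⋃[ W i ] (λ j → ∁ (Σ⁰ (suc n) j))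

  -- A Π⁰ₙ set is taken as the complement of a Σ⁰ₙ set; with excluded middle
  -- this is the same as its complement being Σ⁰ₙ.
  IsΣ⁰ IsΠ⁰ : (n : ℕ) .{{_ : NonZero n}} → Pred X 0ℓ → Set c
  IsΣ⁰ n A = ∃[ i ] A ≐ Σ⁰ n i
  IsΠ⁰ n A = ∃[ i ] A ≐ ∁ (Σ⁰ n i)

  -- i is an index of A as a set that is Σ⁰ₙ in D.
  Σ⁰In : (n : ℕ) .{{_ : NonZero n}} → (D A : Pred X 0ℓ) → ℕ → Set c
  Σ⁰In n D A i = A ≐ D ∩ Σ⁰ n i

  Open : Pred X 0ℓ → Set c
  Open A = ∀ x → x ∈ A → ∃[ r ] 0ℚ ℚ.< r × ball x r ⊆ A

  -- The σ-algebra generated by the open sets.  Countable families are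
  -- indexed by arbitrary subsets of ℕ.
  data Borel : Pred X 0ℓ → Set (c ⊔ lsuc 0ℓ) where
    open′ : ∀ {A} → Open A → Borel A
    compl : ∀ {A} → Borel A → Borel (∁ A)
    union : ∀ I {A} → (∀ i → Borel (A i)) → Borel (⋃[ I ] A)
    resp  : ∀ {A A′} → A ≐ A′ → Borel A → Borel A′

  ball-open : ∀ x r → Open (ball x r)
  ball-open x r y (p , p∉dyx , p<r) =
    r ℚ.- p ,
    subst (ℚ._< r ℚ.- p) (ℚₚ.+-inverseʳ p) (ℚₚ.+-monoˡ-< (ℚ.- p) p<r) ,
    λ {z} (q , q∉dzy , q<r-p) →
      q ℚ.+ p ,
      (λ q+p∈dzx →
        let (a , b , a∈ , b∈ , eq) = d-triangle z y x q+p∈dzx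
        in ℚₚ.<-irrefl (sym eq)
             (ℚₚ.+-mono-< (below (d z y) a∈ q∉dzy) (below (d y x) b∈ p∉dyx))) ,
      subst (q ℚ.+ p ℚ.<_) (trans (ℚₚ.+-comm (r ℚ.- p) p) (p+[q-p]≡q p r))
        (ℚₚ.+-monoˡ-< p q<r-p)

  B-borel : ∀ i → Borel (B i)
  B-borel i = open′ (ball-open _ _)

  Σ⁰-borel : ∀ n .{{_ : NonZero n}} i → Borel (Σ⁰ n i)
  Σ⁰-borel 1             i = union (W i) B-borel
  Σ⁰-borel (suc (suc n)) i = union (W i) (λ j → compl (Σ⁰-borel (suc n) j))

  IsΣ⁰⇒Borel : ∀ n .{{_ : NonZero n}} {A} → IsΣ⁰ n A → Borel A
  IsΣ⁰⇒Borel n (i , A⊆ , ⊆A) = resp (⊆A , A⊆) (Σ⁰-borel n i)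

  IsΠ⁰⇒Borel : ∀ n .{{_ : NonZero n}} {A} → IsΠ⁰ n A → Borel A
  IsΠ⁰⇒Borel n (i , A⊆ , ⊆A) = resp (⊆A , A⊆) (compl (Σ⁰-borel n i))

  U-borel : Borel U
  U-borel = open′ λ _ _ → 1ℚ , ℚₚ.positive⁻¹ 1ℚ , _

------------------------------------------------------------------------
-- Computable probability spaces

record ComputableProbabilitySpace c ℓ : Set (lsuc (c ⊔ ℓ ⊔ lsuc 0ℓ)) where
  field
    metricSpace : ComputableMetricSpace c ℓ

  open ComputableMetricSpace metricSpace public

  -- μ is a function of the Borel set alone, by μ-cong.
  field
    μ                   : ∀ {A} → Borel A → ℝ
    μ-cong              : ∀ {A A′} (a : Borel A) (a′ : Borel A′) → A ≐ A′ → μ a ≈ʳ μ a′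
    μ-nonNeg            : ∀ {A} (a : Borel A) → 0ʳ ≤ʳ μ a
    μ-countablyAdditive : ∀ {A : ℕ → Pred X 0ℓ} (a : ∀ i → Borel (A i)) →
                          (∀ i j → i ≢ j → A i ⊥ A j) →
                          HasSum (λ i → μ (a i)) (μ (union U a))
    μ-total             : μ U-borel ≈ʳ 1ʳ
    μ-lowerSemicomputable :
      UniformlyIn codeList (λ F → LowerSemicomputable (μ (union (_∈ˡ F) B-borel)))

  WeaklyRandom : (n : ℕ) .{{_ : NonZero n}} → X → Set (c ⊔ lsuc 0ℓ)
  WeaklyRandom n x =
    ∀ {P} (Π⁰P : IsΠ⁰ n P) → μ (IsΠ⁰⇒Borel n Π⁰P) ≈ʳ 0ʳ → x ∉ P

  record MeasurePreserving : Set (c ⊔ ℓ ⊔ lsuc 0ℓ) where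
    field
      dom      : Pred X 0ℓ
      T        : ∀ x → x ∈ dom → X
      T-cong   : ∀ {x y} (p : x ∈ dom) (q : y ∈ dom) → x ≈ y → T x p ≈ T y q

    preimage : Pred X 0ℓ → Pred X 0ℓ
    preimage A x = Σ (x ∈ dom) λ p → T x p ∈ A

    field
      measurable : ∀ {A} → Borel A → Borel (preimage A)
      preserves  : ∀ {A} (a : Borel A) → μ (measurable a) ≈ʳ μ a
      invariant  : ∀ x (p : x ∈ dom) → T x p ∈ dom

    iterate′ : ℕ → Σ X dom → Σ X dom
    iterate′ zero    xp = xp
    iterate′ (suc k) xp = let (y , q) = iterate′ k xp in T y q , invariant y q

    -- T^k(x)
    iterate : ℕ → ∀ x → x ∈ dom → X
    iterate k x p = proj₁ (iterate′ k (x , p))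

    IsComputable : Set c
    IsComputable = UniformlyIn id (λ i → Σ⁰In 1 dom (preimage (B i)))

    Ergodic : Set (c ⊔ lsuc 0ℓ)
    Ergodic = ∀ {A} (a : Borel A) → preimage A ≐ A → μ a ≈ʳ 0ʳ ⊎ μ a ≈ʳ 1ʳ

{-# OPTIONS --safe #-}
module Submission where

-- Let E be the set of points whose orbit visits A infinitely often.  It is
-- invariant, and it is the intersection of the decreasing sets "A is visited
-- at some time ≥ N", all of which have the same measure as T preserves μ.
-- So μ(E) ≥ μ(A) > 0, and μ(E) = 1 by ergodicity.  Preimages under T of Σ⁰ₙ
-- sets are Σ⁰ₙ in dom T, uniformly; hence the points visiting A at some time
-- ≥ 1 form V ∩ dom T for a Σ⁰ₙ set V.  The complement of V misses E, so it is
-- a null Π⁰ₙ set and does not contain the weakly random point x.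

open import Defs
open import Algebra.Bundles using (CommutativeRing)
open import Axiom.ExcludedMiddle using (ExcludedMiddle)
open import Data.Empty using (⊥-elim)
open import Data.Integer.Base as ℤ using (+_; -[1+_])
import Data.Integer.Properties as ℤₚ
open import Data.Nat
  using (ℕ; zero; suc; _+_; _⊔_; _≤_; _>_; _≤′_; ≤′-refl; ≤′-step; z≤n; s≤s; z<s; NonZero)
import Data.Nat.Properties as ℕₚ
open import Data.Product using (_×_; _,_; ∃-syntax; proj₁; proj₂)
open import Data.Rational.Base as ℚ using (ℚ; 0ℚ; 1ℚ; mkℚ)
import Data.Rational.Properties as ℚₚ
open import Data.Rational.Unnormalised.Base as ℚᵘ using (mkℚᵘ; *≡*)
import Data.Rational.Unnormalised.Properties as ℚᵘₚ
open import Data.Sum.Base using (inj₁; inj₂; [_,_]′)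
open import Function.Base using (id; _∘_)
open import Function.Bundles using (_⇔_; mk⇔; module Equivalence)
open import Level using (0ℓ)
open import Relation.Binary.Bundles using (Setoid)
open import Relation.Binary.Definitions using (tri<; tri≈; tri>)
open import Relation.Binary.PropositionalEquality
  using (_≡_; _≢_; refl; sym; trans; cong; cong₂; subst; subst₂; module ≡-Reasoning)
open import Relation.Nullary using (¬_; contradiction; yes; no)
open import Relation.Nullary.Decidable using (decidable-stable)
open import Relation.Unary using (Pred; _∈_; _⊆_; _≐_; _∪_; _∖_; _⊥_; ∁; U; ∅)

open import Algebra.Properties.Monoid.Mult ℚₚ.+-0-monoid using () renaming (_×_ to _·_)
open import Algebra.Properties.Semiring.Mult (CommutativeRing.semiring ℚₚ.+-*-commutativeRing)
  using (×-assoc-*)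
open Equivalence using (to; from)

-- Pairing and codes

⟨,⟩-next : ∀ p → ⟨ proj₁ (next p) , proj₂ (next p) ⟩ ≡ suc ⟨ proj₁ p , proj₂ p ⟩
⟨,⟩-next (zero , y) = begin
  triangular (suc y + 0) + 0 ≡⟨ ℕₚ.+-identityʳ _ ⟩
  triangular (suc y + 0)     ≡⟨ cong (triangular ∘ suc) (ℕₚ.+-identityʳ y) ⟩
  suc y + triangular y       ≡⟨ cong suc (ℕₚ.+-comm y (triangular y)) ⟩
  suc (triangular y + y)     ∎
  where open ≡-Reasoning
⟨,⟩-next (suc x , y) = begin
  triangular (x + suc y) + suc y   ≡⟨ ℕₚ.+-suc _ y ⟩
  suc (triangular (x + suc y) + y) ≡⟨ cong (λ z → suc (triangular z + y)) (ℕₚ.+-suc x y) ⟩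
  suc (triangular (suc x + y) + y) ∎
  where open ≡-Reasoning

⟨,⟩-unpair : ∀ n → ⟨ π₁ n , π₂ n ⟩ ≡ n
⟨,⟩-unpair zero    = refl
⟨,⟩-unpair (suc n) = trans (⟨,⟩-next (unpair n)) (cong suc (⟨,⟩-unpair n))

unpair-⟨,⟩ : ∀ x y → unpair ⟨ x , y ⟩ ≡ (x , y)
unpair-⟨,⟩ x y = onDiagonal (x + y) x y refl
  where
  -- Lexicographic descent on the diagonal s and then on y: a pair with y > 0 succeeds its neighbour
  -- on the same diagonal, and (x + 1, 0) succeeds (0, x) on the previous one.
  onDiagonal : ∀ s x y → x + y ≡ s → unpair ⟨ x , y ⟩ ≡ (x , y)
  onDiagonal s x (suc y) eq = trans
    (cong unpair (⟨,⟩-next (suc x , y)))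
    (cong next (onDiagonal s (suc x) y (trans (sym (ℕₚ.+-suc x y)) eq)))
  onDiagonal s       zero    zero _    = refl
  onDiagonal (suc s) (suc x) zero refl = trans
    (cong unpair (⟨,⟩-next (zero , x)))
    (cong next (onDiagonal s zero x (sym (ℕₚ.+-identityʳ x))))

π₁-⟨,⟩ : ∀ x y → π₁ ⟨ x , y ⟩ ≡ x
π₁-⟨,⟩ x y = cong proj₁ (unpair-⟨,⟩ x y)

π₂-⟨,⟩ : ∀ x y → π₂ ⟨ x , y ⟩ ≡ y
π₂-⟨,⟩ x y = cong proj₂ (unpair-⟨,⟩ x y)

⟨,⟩-injective : ∀ a b c d → ⟨ a , b ⟩ ≡ ⟨ c , d ⟩ → a ≡ c × b ≡ d
⟨,⟩-injective a b c d eq = cong proj₁ pairs , cong proj₂ pairs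
  where
  pairs : (a , b) ≡ (c , d)
  pairs = trans (sym (unpair-⟨,⟩ a b)) (trans (cong unpair eq) (unpair-⟨,⟩ c d))

-- Codes are determined by their numbers

tag : Code → ℕ
tag zer        = 0
tag suc′       = 1
tag left       = 2
tag right      = 3
tag (pair _ _) = 4
tag (comp _ _) = 5
tag (prec _ _) = 6
tag (mu _)     = 7
tag univ       = 8

π₁-encode : ∀ c → π₁ (encode c) ≡ tag c
π₁-encode zer        = refl
π₁-encode suc′       = refl
π₁-encode left       = refl
π₁-encode right      = refl
π₁-encode (pair f g) = π₁-⟨,⟩ 4 ⟨ encode f , encode g ⟩
π₁-encode (comp f g) = π₁-⟨,⟩ 5 ⟨ encode f , encode g ⟩
π₁-encode (prec f g) = π₁-⟨,⟩ 6 ⟨ encode f , encode g ⟩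
π₁-encode (mu f)     = π₁-⟨,⟩ 7 (encode f)
π₁-encode univ       = refl

depth : Code → ℕ
depth (pair f g) = suc (depth f ⊔ depth g)
depth (comp f g) = suc (depth f ⊔ depth g)
depth (prec f g) = suc (depth f ⊔ depth g)
depth (mu f)     = suc (depth f)
depth _          = 1

decodeNode : (ℕ → Code) → ℕ × ℕ → Code
decodeNode r (0 , _) = zer
decodeNode r (1 , _) = suc′
decodeNode r (2 , _) = left
decodeNode r (3 , _) = right
decodeNode r (4 , p) = pair (r (π₁ p)) (r (π₂ p))
decodeNode r (5 , p) = comp (r (π₁ p)) (r (π₂ p))
decodeNode r (6 , p) = prec (r (π₁ p)) (r (π₂ p))
decodeNode r (7 , p) = mu (r p)
decodeNode r (_ , _) = univ

-- The first argument bounds the depth of the code that is read.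
decode : ℕ → ℕ → Code
decode zero    n = zer
decode (suc k) n = decodeNode (decode k) (unpair n)

decode-encode : ∀ k c → depth c ≤ k → decode k (encode c) ≡ c
decode-encode (suc k) zer        _ = refl
decode-encode (suc k) suc′       _ = refl
decode-encode (suc k) left       _ = refl
decode-encode (suc k) right      _ = refl
decode-encode (suc k) univ       _ = refl
decode-encode (suc k) (mu f) (s≤s f≤k)
  rewrite unpair-⟨,⟩ 7 (encode f) = cong mu (decode-encode k f f≤k)
decode-encode (suc k) (pair f g) (s≤s fg≤k)
  rewrite unpair-⟨,⟩ 4 ⟨ encode f , encode g ⟩ | unpair-⟨,⟩ (encode f) (encode g)
  = cong₂ pair (decode-encode k f (ℕₚ.m⊔n≤o⇒m≤o _ _ fg≤k))
               (decode-encode k g (ℕₚ.m⊔n≤o⇒n≤o _ _ fg≤k))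
decode-encode (suc k) (comp f g) (s≤s fg≤k)
  rewrite unpair-⟨,⟩ 5 ⟨ encode f , encode g ⟩ | unpair-⟨,⟩ (encode f) (encode g)
  = cong₂ comp (decode-encode k f (ℕₚ.m⊔n≤o⇒m≤o _ _ fg≤k))
               (decode-encode k g (ℕₚ.m⊔n≤o⇒n≤o _ _ fg≤k))
decode-encode (suc k) (prec f g) (s≤s fg≤k)
  rewrite unpair-⟨,⟩ 6 ⟨ encode f , encode g ⟩ | unpair-⟨,⟩ (encode f) (encode g)
  = cong₂ prec (decode-encode k f (ℕₚ.m⊔n≤o⇒m≤o _ _ fg≤k))
               (decode-encode k g (ℕₚ.m⊔n≤o⇒n≤o _ _ fg≤k))

encode-injective : ∀ c c′ → encode c ≡ encode c′ → c ≡ c′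
encode-injective c c′ eq = begin
  c                    ≡⟨ decode-encode k c (ℕₚ.m≤m⊔n _ _) ⟨
  decode k (encode c)  ≡⟨ cong (decode k) eq ⟩
  decode k (encode c′) ≡⟨ decode-encode k c′ (ℕₚ.m≤n⊔m (depth c) _) ⟩
  c′                   ∎
  where
  open ≡-Reasoning

  k : ℕ
  -- Deep enough for both codes, so a single decoder inverts `encode` on each.
  k = depth c ⊔ depth c′

-- In the `mu` case the smaller of two distinct results would be a zero of f by one derivation and
-- have a successor value by the other. The `univ` case records only the number of the code it runs,
-- hence `encode-injective`.
⇓-deterministic : ∀ {c n a b} → c [ n ]⇓ a → c [ n ]⇓ b → a ≡ b
⇓-deterministic zer⇓   zer⇓   = refl
⇓-deterministic suc⇓   suc⇓   = refl
⇓-deterministic left⇓  left⇓  = refl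
⇓-deterministic right⇓ right⇓ = refl
⇓-deterministic (pair⇓ f⇓ g⇓) (pair⇓ f⇓′ g⇓′) =
  cong₂ ⟨_,_⟩ (⇓-deterministic f⇓ f⇓′) (⇓-deterministic g⇓ g⇓′)
⇓-deterministic (comp⇓ g⇓ f⇓) (comp⇓ g⇓′ f⇓′) with refl ← ⇓-deterministic g⇓ g⇓′ =
  ⇓-deterministic f⇓ f⇓′
⇓-deterministic (prec⇓₀ _ f⇓) (prec⇓₀ _ f⇓′) = ⇓-deterministic f⇓ f⇓′
⇓-deterministic (prec⇓₀ eq _) (prec⇓ₛ eq′ _ _) = contradiction (trans (sym eq) eq′) λ ()
⇓-deterministic (prec⇓ₛ eq _ _) (prec⇓₀ eq′ _) = contradiction (trans (sym eq′) eq) λ ()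
⇓-deterministic (prec⇓ₛ eq r⇓ g⇓) (prec⇓ₛ eq′ r⇓′ g⇓′) with refl ← trans (sym eq) eq′
  with refl ← ⇓-deterministic r⇓ r⇓′ = ⇓-deterministic g⇓ g⇓′
⇓-deterministic (mu⇓ {k = k} f⇓ below) (mu⇓ {k = k′} f⇓′ below′) with ℕₚ.<-cmp k k′
... | tri< k<k′ _ _ = contradiction (⇓-deterministic f⇓ (proj₂ (below′ k k<k′))) λ ()
... | tri≈ _ eq _   = eq
... | tri> _ _ k>k′ with (_ , f⇓″) ← below k′ k>k′ =
  contradiction (⇓-deterministic f⇓″ f⇓′) λ ()
⇓-deterministic (univ⇓ {c} eq c⇓) (univ⇓ {c′} eq′ c⇓′)
  with refl ← encode-injective c c′ (trans eq (sym eq′)) = ⇓-deterministic c⇓ c⇓′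

-- Computable functions and their codes

Computes : Code → (ℕ → ℕ) → Set
Computes c f = ∀ n → c [ n ]⇓ f n

-- `Computable` provides a code separately for each argument, all with number e. By injectivity of
-- `encode` they coincide with the one found at argument 0.
computable⇒code : ∀ {f} → Computable f → ∃[ c ] Computes c f
computable⇒code (e , e⇓) with (c , refl , _) ← e⇓ 0 = c , λ n → ofIndex (e⇓ n)
  where
  ofIndex : ∀ {n a} → encode c ∙ n ⇓ a → c [ n ]⇓ a
  ofIndex {n} {a} (c′ , eq , c⇓) = subst (_[ n ]⇓ a) (encode-injective c′ c eq) c⇓

code⇒computable : ∀ {f} c → Computes c f → Computable f
code⇒computable c c⇓ = encode c , λ n → c , refl , c⇓ n

constant : ℕ → Code
constant zero    = zer
constant (suc a) = comp suc′ (constant a)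

constant-computes : ∀ a → Computes (constant a) (λ _ → a)
constant-computes zero    n = zer⇓
constant-computes (suc a) n = comp⇓ (constant-computes a n) suc⇓

-- There is no primitive identity, but every number is the pair of its projections.
identity : Code
identity = pair left right

identity-computes : Computes identity id
identity-computes n = subst (identity [ n ]⇓_) (⟨,⟩-unpair n) (pair⇓ left⇓ right⇓)

comp-computes : ∀ {c c′ f g} → Computes c f → Computes c′ g → Computes (comp c c′) (f ∘ g)
comp-computes c⇓ c′⇓ n = comp⇓ (c′⇓ n) (c⇓ _)

pair-computes : ∀ {c c′ f g} → Computes c f → Computes c′ g →
  Computes (pair c c′) (λ n → ⟨ f n , g n ⟩)
pair-computes c⇓ c′⇓ n = pair⇓ (c⇓ n) (c′⇓ n)

iter : (ℕ → ℕ) → ℕ → ℕ → ℕ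
iter f a zero    = a
iter f a (suc k) = f (iter f a k)

-- Serves to list the indices of the successive preimages of a set.
iter-computable : ∀ {f} → Computable f → ∀ a → Computable (λ k → iter f a k)
iter-computable {f} f-computable a with (c , c⇓) ← computable⇒code f-computable =
  -- `prec` expects a packed parameter and counter; the parameter is a dummy 0.
  code⇒computable (comp recursion (pair zer identity))
    λ k → comp⇓ (pair⇓ zer⇓ (identity-computes k)) (recursion⇓ k ⟨ 0 , k ⟩ (π₂-⟨,⟩ 0 k))
  where
  recursion : Code
  recursion = prec (constant a) (comp c (comp right right))

  -- The counter is tied to n by an equation, because the projections of a pair do not reduce to its
  -- components.
  recursion⇓ : ∀ k n → π₂ n ≡ k → recursion [ n ]⇓ iter f a k
  recursion⇓ zero    n eq = prec⇓₀ eq (constant-computes a _)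
  recursion⇓ (suc k) n eq =
    prec⇓ₛ eq (recursion⇓ k ⟨ π₁ n , k ⟩ (π₂-⟨,⟩ (π₁ n) k)) (comp⇓ right² (c⇓ _))
    where
    b : ℕ
    b = iter f a k

    right² : comp right right [ ⟨ π₁ n , ⟨ k , b ⟩ ⟩ ]⇓ b
    right² = subst (comp right right [ ⟨ π₁ n , ⟨ k , b ⟩ ⟩ ]⇓_)
      (trans (cong π₂ (π₂-⟨,⟩ (π₁ n) ⟨ k , b ⟩)) (π₂-⟨,⟩ k b)) (comp⇓ right⇓ right⇓)

-- Indices of images and unions of c.e. sets

comp-tag : ∀ c → π₁ (encode c) ≡ 5 → ∃[ f ] ∃[ g ] c ≡ comp f g
comp-tag c eq = byTag c (trans (sym (π₁-encode c)) eq)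
  where
  -- `tag` computes to a numeral on every constructor, so the other cases are absurd;
  -- `π₁ (encode c)` is stuck on compound codes.
  byTag : ∀ c → tag c ≡ 5 → ∃[ f ] ∃[ g ] c ≡ comp f g
  byTag (comp f g) _ = f , g , refl

pair-tag : ∀ c → π₁ (encode c) ≡ 4 → ∃[ f ] ∃[ g ] c ≡ pair f g
pair-tag c eq = byTag c (trans (sym (π₁-encode c)) eq)
  where
  byTag : ∀ c → tag c ≡ 4 → ∃[ f ] ∃[ g ] c ≡ pair f g
  byTag (pair f g) _ = f , g , refl

-- Opaque because unfolding ⟨_,_⟩ on nested numerals explodes.
opaque
  compIndex pairIndex : ℕ → ℕ → ℕ
  compIndex a b = ⟨ 5 , ⟨ a , b ⟩ ⟩
  pairIndex a b = ⟨ 4 , ⟨ a , b ⟩ ⟩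

  encode-comp : ∀ f g → encode (comp f g) ≡ compIndex (encode f) (encode g)
  encode-comp f g = refl

  encode-pair : ∀ f g → encode (pair f g) ≡ pairIndex (encode f) (encode g)
  encode-pair f g = refl

  encode≡compIndex : ∀ c a b → encode c ≡ compIndex a b →
    ∃[ f ] ∃[ g ] c ≡ comp f g × encode f ≡ a × encode g ≡ b
  encode≡compIndex c a b eq
    with (f , g , refl) ← comp-tag c (trans (cong π₁ eq) (π₁-⟨,⟩ 5 ⟨ a , b ⟩)) =
    f , g , refl ,
    ⟨,⟩-injective (encode f) _ a b (proj₂ (⟨,⟩-injective 5 ⟨ encode f , encode g ⟩ 5 ⟨ a , b ⟩ eq))

  encode≡pairIndex : ∀ c a b → encode c ≡ pairIndex a b →
    ∃[ f ] ∃[ g ] c ≡ pair f g × encode f ≡ a × encode g ≡ b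
  encode≡pairIndex c a b eq
    with (f , g , refl) ← pair-tag c (trans (cong π₁ eq) (π₁-⟨,⟩ 4 ⟨ a , b ⟩)) =
    f , g , refl ,
    ⟨,⟩-injective (encode f) _ a b (proj₂ (⟨,⟩-injective 4 ⟨ encode f , encode g ⟩ 4 ⟨ a , b ⟩ eq))

  compIndex-computes : ∀ {c c′ f g} → Computes c f → Computes c′ g →
    Computes (pair (constant 5) (pair c c′)) (λ n → compIndex (f n) (g n))
  compIndex-computes c⇓ c′⇓ = pair-computes (constant-computes 5) (pair-computes c⇓ c′⇓)

  pairIndex-computes : ∀ {c c′ f g} → Computes c f → Computes c′ g →
    Computes (pair (constant 4) (pair c c′)) (λ n → pairIndex (f n) (g n))
  pairIndex-computes c⇓ c′⇓ = pair-computes (constant-computes 4) (pair-computes c⇓ c′⇓)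

-- W (imageIndex c i) is the image of W i under the function with code c, and
-- W (unionIndex i) is the union of the W j with j ∈ W i.  If i is not the
-- number of a code, neither are these indices, and all three sets are empty.
imageIndex : Code → ℕ → ℕ
imageIndex c i = compIndex (encode c) i

unionIndex : ℕ → ℕ
unionIndex i = compIndex (encode univ) (pairIndex (compIndex i (encode left)) (encode right))

imageIndex-computable : ∀ c → Computable (imageIndex c)
imageIndex-computable c =
  code⇒computable _ (compIndex-computes (constant-computes (encode c)) identity-computes)

unionIndex-computable : Computable unionIndex
unionIndex-computable = code⇒computable _
  (compIndex-computes (constant-computes (encode univ))
    (pairIndex-computes
      (compIndex-computes identity-computes (constant-computes (encode left)))
      (constant-computes (encode right))))

∘-computable : ∀ {f g} → Computable f → Computable g → Computable (f ∘ g)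
∘-computable f-computable g-computable =
  let (_ , c⇓)  = computable⇒code f-computable
      (_ , c′⇓) = computable⇒code g-computable
  in code⇒computable _ (comp-computes c⇓ c′⇓)

∈-image⁺ : ∀ {c f i j} → Computes c f → W i j → W (imageIndex c i) (f j)
∈-image⁺ {c} {j = j} c⇓ (x , I , refl , I⇓) = x , comp c I , encode-comp c I , comp⇓ I⇓ (c⇓ j)

-- Nothing says that i is the number of a code. Membership supplies a code with the composite
-- number; it must be a composition, and its inner part has number i.
∈-image⁻ : ∀ {c f i l} → Computes c f → W (imageIndex c i) l → ∃[ j ] W i j × l ≡ f j
∈-image⁻ {c} {i = i} c⇓ (x , C , eq , C⇓)
  with (g , I , refl , g≡ , I≡) ← encode≡compIndex C (encode c) i eq
  with refl ← encode-injective g c g≡ | comp⇓ {a = j} I⇓ g⇓ ← C⇓ =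
  j , (x , I , I≡ , I⇓) , ⇓-deterministic g⇓ (c⇓ j)

-- An input packs an argument for I with an argument for the function whose index I returns, so all
-- pairs of searches occur in one range.
unionCode : Code → Code
unionCode I = comp univ (pair (comp I left) right)

encode-unionCode : ∀ I → encode (unionCode I) ≡ unionIndex (encode I)
encode-unionCode I = trans (encode-comp univ (pair (comp I left) right))
  (cong (compIndex (encode univ)) (trans (encode-pair (comp I left) right)
    (cong (λ a → pairIndex a (encode right)) (encode-comp I left))))

encode≡unionIndex : ∀ c i → encode c ≡ unionIndex i → ∃[ I ] encode I ≡ i × c ≡ unionCode I
encode≡unionIndex c i eq
  with (g , P , refl , g≡ , P≡) ← encode≡compIndex c _ _ eq
  with (Q , R , refl , Q≡ , R≡) ← encode≡pairIndex P _ _ P≡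
  with (I , L , refl , I≡ , L≡) ← encode≡compIndex Q _ _ Q≡
  with refl ← encode-injective g univ g≡ | refl ← encode-injective R right R≡
     | refl ← encode-injective L left L≡ =
  I , I≡ , refl

∈-union⁺ : ∀ {i j l} → W i j → W j l → W (unionIndex i) l
∈-union⁺ {i} {j} {l} (x , I , refl , I⇓) (y , J , refl , J⇓) =
  ⟨ x , y ⟩ , unionCode I , encode-unionCode I ,
  comp⇓ (pair⇓ (comp⇓ left⇓ (subst (I [_]⇓ j) (sym (π₁-⟨,⟩ x y)) I⇓)) right⇓)
        (univ⇓ (sym (π₁-⟨,⟩ j (π₂ ⟨ x , y ⟩)))
          (subst (J [_]⇓ l) (sym (trans (π₂-⟨,⟩ j (π₂ ⟨ x , y ⟩)) (π₂-⟨,⟩ x y))) J⇓))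

unionCode⇓⁻ : ∀ {I x l} → unionCode I [ x ]⇓ l → ∃[ y ] ∃[ j ] I [ y ]⇓ j × W j l
unionCode⇓⁻ (comp⇓ (pair⇓ {a = j} {b = b} (comp⇓ {a = y} _ I⇓) _) (univ⇓ {c} c≡ c⇓)) =
  y , j , I⇓ , (π₂ ⟨ j , b ⟩ , c , trans c≡ (π₁-⟨,⟩ j b) , c⇓)

∈-union⁻ : ∀ {i l} → W (unionIndex i) l → ∃[ j ] W i j × W j l
∈-union⁻ {i} {l} (x , C , eq , C⇓) =
  let (I , I≡ , C≡)       = encode≡unionIndex C i eq
      (y , j , I⇓ , l∈Wj) = unionCode⇓⁻ (subst (_[ x ]⇓ l) C≡ C⇓)
  in j , (y , I , I≡ , I⇓) , l∈Wj

range-index : ∀ {f} → Computable f → ∃[ e ] (∀ j → W e j ⇔ (∃[ k ] j ≡ f k))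
range-index {f} f-computable =
  let (c , c⇓) = computable⇒code f-computable
  in encode c , λ j → mk⇔
    (λ (k , c′ , eq , c′⇓) →
      k , ⇓-deterministic (subst (_[ k ]⇓ j) (encode-injective c′ c eq) c′⇓) (c⇓ k))
    (λ { (k , refl) → k , c , refl , c⇓ k })

-- Real numbers

toℚᵘ-·1 : ∀ k → ℚ.toℚᵘ (k · 1ℚ) ℚᵘ.≃ mkℚᵘ (+ k) 0
toℚᵘ-·1 zero    = ℚᵘₚ.≃-refl
toℚᵘ-·1 (suc k) = ℚᵘₚ.≃-trans (ℚₚ.toℚᵘ-homo-+ 1ℚ (k · 1ℚ))
  (ℚᵘₚ.≃-trans (ℚᵘₚ.+-congʳ (mkℚᵘ (+ 1) 0) (toℚᵘ-·1 k))
    (*≡* (cong (λ z → ((+ 1) ℤ.+ z) ℤ.* (+ 1)) (ℤₚ.*-identityʳ (+ k)))))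

p≤k·1 : ∀ p → ∃[ k ] p ℚ.≤ k · 1ℚ
p≤k·1 (mkℚ n d-1 _) = ℤ.∣ n ∣ , ℚₚ.toℚᵘ-cancel-≤
  (ℚᵘₚ.≤-trans (ℚᵘ.*≤* (n≤∣n∣*d n)) (ℚᵘₚ.≤-reflexive (ℚᵘₚ.≃-sym (toℚᵘ-·1 ℤ.∣ n ∣))))
  where
  n≤∣n∣*d : ∀ n → n ℤ.* (+ 1) ℤ.≤ + ℤ.∣ n ∣ ℤ.* + suc d-1
  n≤∣n∣*d (+ m)    = subst₂ ℤ._≤_ (sym (ℤₚ.*-identityʳ (+ m))) (ℤₚ.pos-* m (suc d-1))
    (ℤ.+≤+ (ℕₚ.m≤m*n m (suc d-1)))
  n≤∣n∣*d -[1+ m ] = ℤ.-≤+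

archimedean : ∀ p {ε} → 0ℚ ℚ.< ε → ∃[ k ] p ℚ.≤ k · ε
archimedean p {ε} ε>0 = let (k , r≤k) = p≤k·1 r in k , (begin
  p                    ≡⟨ ℚₚ.*-identityʳ p ⟨
  p ℚ.* 1ℚ             ≡⟨ cong (p ℚ.*_) (ℚₚ.*-inverseˡ ε) ⟨
  p ℚ.* (ℚ.1/ ε ℚ.* ε) ≡⟨ ℚₚ.*-assoc p (ℚ.1/ ε) ε ⟨
  r ℚ.* ε              ≤⟨ ℚₚ.*-monoʳ-≤-nonNeg ε r≤k ⟩
  (k · 1ℚ) ℚ.* ε       ≡⟨ ×-assoc-* k 1ℚ ε ⟩
  k · (1ℚ ℚ.* ε)       ≡⟨ cong (k ·_) (ℚₚ.*-identityˡ ε) ⟩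
  k · ε                ∎)
  where
  open ℚₚ.≤-Reasoning

  instance
    ε-positive : ℚ.Positive ε
    ε-positive = ℚ.positive ε>0
    ε-nonNegative : ℚ.NonNegative ε
    ε-nonNegative = ℚₚ.pos⇒nonNeg ε
    ε-nonZero : ℚ.NonZero ε
    ε-nonZero = ℚₚ.pos⇒nonZero ε

  r : ℚ
  r = p ℚ.* ℚ.1/ ε

p<q⇒0<q-p : ∀ {p q} → p ℚ.< q → 0ℚ ℚ.< q ℚ.- p
p<q⇒0<q-p {p} {q} p<q = subst (ℚ._< q ℚ.- p) (ℚₚ.+-inverseʳ p) (ℚₚ.+-monoˡ-< (ℚ.- p) p<q)

p<q⇒p-q<0 : ∀ {p q} → p ℚ.< q → p ℚ.- q ℚ.< 0ℚ
p<q⇒p-q<0 {p} {q} p<q = subst (p ℚ.- q ℚ.<_) (ℚₚ.+-inverseʳ q) (ℚₚ.+-monoˡ-< (ℚ.- q) p<q)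

-- The arithmetic behind cancellation: with a < p the sum a + b would fall below q + z.
excess-bound : ∀ {p q z a b} → q ℚ.+ z ≡ a ℚ.+ b → b ℚ.< z ℚ.+ (q ℚ.- p) → p ℚ.≤ a
excess-bound {p} {q} {z} {a} {b} eq b<z+q-p = ℚₚ.≮⇒≥ λ a<p → ℚₚ.<-irrefl refl (begin-strict
  q ℚ.+ z                   ≡⟨ eq ⟩
  a ℚ.+ b                   <⟨ ℚₚ.+-mono-< a<p b<z+q-p ⟩
  p ℚ.+ (z ℚ.+ (q ℚ.- p))   ≡⟨ cong (p ℚ.+_) (ℚₚ.+-assoc z q (ℚ.- p)) ⟨
  p ℚ.+ ((z ℚ.+ q) ℚ.- p)   ≡⟨ p+[q-p]≡q p (z ℚ.+ q) ⟩
  z ℚ.+ q                   ≡⟨ ℚₚ.+-comm z q ⟩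
  q ℚ.+ z                   ∎)
  where open ℚₚ.≤-Reasoning

≤ʳ-trans : ∀ {x y z} → x ≤ʳ y → y ≤ʳ z → x ≤ʳ z
≤ʳ-trans x≤y y≤z q∈x = y≤z (x≤y q∈x)

+ʳ-mono-≤ʳ : ∀ {x x′ y y′} → x ≤ʳ x′ → y ≤ʳ y′ → x +ʳ y ≤ʳ x′ +ʳ y′
+ʳ-mono-≤ʳ x≤x′ y≤y′ (a , b , a∈x , b∈y , eq) = a , b , x≤x′ a∈x , y≤y′ b∈y , eq

+ʳ-monoˡ-≤ʳ : ∀ z x y → x ≤ʳ y → x +ʳ z ≤ʳ y +ʳ z
+ʳ-monoˡ-≤ʳ z x y x≤y = +ʳ-mono-≤ʳ {x} {y} {z} {z} x≤y λ q∈z → q∈z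

+ʳ-monoʳ-≤ʳ : ∀ z x y → x ≤ʳ y → z +ʳ x ≤ʳ z +ʳ y
+ʳ-monoʳ-≤ʳ z x y = +ʳ-mono-≤ʳ {z} {z} {x} {y} λ q∈z → q∈z

+ʳ-comm-≤ʳ : ∀ x y → x +ʳ y ≤ʳ y +ʳ x
+ʳ-comm-≤ʳ x y (a , b , a∈x , b∈y , eq) = b , a , b∈y , a∈x , trans eq (ℚₚ.+-comm a b)

x+0≤x : ∀ x → x +ʳ 0ʳ ≤ʳ x
x+0≤x x (a , b , a∈x , b<0 , refl) =
  ℝ.downward x (subst (a ℚ.+ b ℚ.≤_) (ℚₚ.+-identityʳ a) (ℚₚ.+-monoʳ-≤ a (ℚₚ.<⇒≤ b<0))) a∈x

-- Roundedness gives a larger q in x, so that the remainder p - q is strictly negative, as the cut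
-- of 0 demands.
x≤x+0 : ∀ x → x ≤ʳ x +ʳ 0ʳ
x≤x+0 x {p} p∈x = let (q , p<q , q∈x) = ℝ.rounded x p∈x in
  q , p ℚ.- q , q∈x , p<q⇒p-q<0 p<q , sym (p+[q-p]≡q q p)

0+x≤x : ∀ x → 0ʳ +ʳ x ≤ʳ x
0+x≤x x = ≤ʳ-trans {0ʳ +ʳ x} {x +ʳ 0ʳ} {x} (+ʳ-comm-≤ʳ 0ʳ x) (x+0≤x x)

x≤0+x : ∀ x → x ≤ʳ 0ʳ +ʳ x
x≤0+x x = ≤ʳ-trans {x} {x +ʳ 0ʳ} {0ʳ +ʳ x} (x≤x+0 x) (+ʳ-comm-≤ʳ x 0ʳ)

<ʳ⇒≱ʳ : ∀ {x y} → x <ʳ y → ¬ (y ≤ʳ x)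
<ʳ⇒≱ʳ (q , q∉x , q∈y) y≤x = q∉x (y≤x q∈y)

x<y+ε⇒x≤y : ∀ {x y} → (∀ ε → 0ℚ ℚ.< ε → x <ʳ y +ʳ fromℚ ε) → x ≤ʳ y
x<y+ε⇒x≤y {x} {y} x<y+ε {p} p∈x =
  let (q , p<q , q∈x)                      = ℝ.rounded x p∈x
      -- The gap between p and a larger member q of x is the tolerance ε.
      (r , r∉x , a , b , a∈y , b<q-p , r≡) = x<y+ε (q ℚ.- p) (p<q⇒0<q-p p<q)
  in ℝ.downward y (ℚₚ.<⇒≤ (bound (below x q∈x r∉x) b<q-p r≡)) a∈y
  where
  bound : ∀ {q r a b} → q ℚ.< r → b ℚ.< q ℚ.- p → r ≡ a ℚ.+ b → p ℚ.< a
  bound {q} {r} {a} {b} q<r b<q-p r≡ = ℚₚ.≰⇒> λ a≤p → ℚₚ.<-irrefl refl (begin-strict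
    q                 <⟨ q<r ⟩
    r                 ≡⟨ r≡ ⟩
    a ℚ.+ b           <⟨ ℚₚ.+-mono-≤-< a≤p b<q-p ⟩
    p ℚ.+ (q ℚ.- p)   ≡⟨ p+[q-p]≡q p q ⟩
    q                 ∎)
    where open ℚₚ.≤-Reasoning

-- The partial sum at N + M is both past the convergence threshold M and in the range where the
-- bound is assumed.
HasSum-≤ : ∀ u s t N → HasSum u s → (∀ n → sumʳ u (N + n) ≤ʳ t) → s ≤ʳ t
HasSum-≤ u s t N sums sum≤t = x<y+ε⇒x≤y {s} {t} λ ε ε>0 →
  let (M , within)        = sums ε ε>0
      (q , q∉s , q∈sum+ε) = proj₂ (within (N + M) (ℕₚ.m≤n+m M N))
  in q , q∉s , +ʳ-monoˡ-≤ʳ (fromℚ ε) (sumʳ u (N + M)) t (sum≤t M) q∈sum+ε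

HasSum-≥ : ∀ u s t N → HasSum u s → (∀ n → t ≤ʳ sumʳ u (N + n)) → t ≤ʳ s
HasSum-≥ u s t N sums t≤sum = x<y+ε⇒x≤y {t} {s} λ ε ε>0 →
  let (M , within)        = sums ε ε>0
      (q , q∉sum , q∈s+ε) = proj₁ (within (N + M) (ℕₚ.m≤n+m M N))
  in q , (λ q∈t → q∉sum (t≤sum M q∈t)) , q∈s+ε

-- Cancellation for Dedekind cuts

module _ (em : ExcludedMiddle 0ℓ) where

  -- If every step of length ε from a member of the cut stayed inside, then finitely many steps
  -- would carry a member past an upper bound.
  locate : ∀ x {ε} → 0ℚ ℚ.< ε → ∃[ q ] Lower x q × ¬ Lower x (q ℚ.+ ε)
  locate x {ε} ε>0 = decidable-stable em λ none →
    let (p , p∈x)    = ℝ.inhabited x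
        (r , r∉x)    = ℝ.bounded x
        (k , r-p≤kε) = archimedean (r ℚ.- p) ε>0
        r≤p+kε       = subst (ℚ._≤ p ℚ.+ k · ε) (p+[q-p]≡q p r) (ℚₚ.+-monoʳ-≤ p r-p≤kε)
    in r∉x (ℝ.downward x r≤p+kε (walk none k p∈x))
    where
    walk : ¬ (∃[ q ] Lower x q × ¬ Lower x (q ℚ.+ ε)) →
           ∀ k {q} → Lower x q → Lower x (q ℚ.+ k · ε)
    walk none zero    {q} q∈x = subst (Lower x) (sym (ℚₚ.+-identityʳ q)) q∈x
    walk none (suc k) {q} q∈x = subst (Lower x) (ℚₚ.+-assoc q ε (k · ε))
      (walk none k (decidable-stable em λ q+ε∉x → none (q , q∈x , q+ε∉x)))

  -- Take p < q below x and c in z with c + (q - p) outside z. Splitting q + c as a + b with a in y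
  -- and b in z forces b < c + (q - p), hence p ≤ a.
  +ʳ-cancelʳ-≤ʳ : ∀ x y z → x +ʳ z ≤ʳ y +ʳ z → x ≤ʳ y
  +ʳ-cancelʳ-≤ʳ x y z x+z≤y+z {p} p∈x =
    let (q , p<q , q∈x)          = ℝ.rounded x p∈x
        (c , c∈z , c+q-p∉z)      = locate z (p<q⇒0<q-p p<q)
        (a , b , a∈y , b∈z , eq) = x+z≤y+z (q , c , q∈x , c∈z , refl)
    in ℝ.downward y (excess-bound {p} {q} {c} eq (below z b∈z c+q-p∉z)) a∈y

  +ʳ-cancelˡ-≤ʳ : ∀ x y z → z +ʳ x ≤ʳ z +ʳ y → x ≤ʳ y
  +ʳ-cancelˡ-≤ʳ x y z z+x≤z+y = +ʳ-cancelʳ-≤ʳ x y z λ h →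
    +ʳ-comm-≤ʳ z y (z+x≤z+y (+ʳ-comm-≤ʳ x z h))

-- Borel sets and measure

module MetricSpaceProperties {c ℓ} (ℳ : ComputableMetricSpace c ℓ) where
  open ComputableMetricSpace ℳ
  open Setoid setoid using () renaming (sym to ≈-sym)

  -- An arbitrary predicate may separate equal points. An open set cannot, since it contains a ball
  -- about each of its points, and the Borel operations keep this property.
  borel-respects-≈ : ∀ {A x y} → Borel A → x ≈ y → x ∈ A → y ∈ A
  borel-respects-≈ {x = x} {y} (open′ A-open) x≈y x∈A =
    let (r , 0<r , ball⊆A) = A-open x x∈A
    in ball⊆A (0ℚ , (λ 0∈dyx → ℚₚ.<-irrefl refl (proj₁ (≈⇒d≈0 (≈-sym x≈y)) 0∈dyx)) , 0<r)
  borel-respects-≈ (compl a) x≈y x∉A y∈A = x∉A (borel-respects-≈ a (≈-sym x≈y) y∈A)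
  borel-respects-≈ (union I a) x≈y (i , i∈I , x∈Aᵢ) = i , i∈I , borel-respects-≈ (a i) x≈y x∈Aᵢ
  borel-respects-≈ (resp (A⊆A′ , A′⊆A) a) x≈y x∈A′ =
    A⊆A′ (borel-respects-≈ a x≈y (A′⊆A x∈A′))

  ∅-borel : Borel ∅
  ∅-borel = open′ λ _ ()

  -- Presents a union of two sets as a countable one, to which countable additivity applies.
  pad : Pred X 0ℓ → Pred X 0ℓ → ℕ → Pred X 0ℓ
  pad A B 0             = A
  pad A B 1             = B
  pad A B (suc (suc _)) = ∅

  pad-borel : ∀ {A B} → Borel A → Borel B → ∀ i → Borel (pad A B i)
  pad-borel a b 0             = a
  pad-borel a b 1             = b
  pad-borel a b (suc (suc _)) = ∅-borel

  pad-disjoint : ∀ {A B} → A ⊥ B → ∀ i j → i ≢ j → pad A B i ⊥ pad A B j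
  pad-disjoint A⊥B 0 0             i≢j _       = i≢j refl
  pad-disjoint A⊥B 0 1             _   x∈      = A⊥B x∈
  pad-disjoint A⊥B 1 0             _   (p , q) = A⊥B (q , p)
  pad-disjoint A⊥B 1 1             i≢j _       = i≢j refl
  pad-disjoint A⊥B 0 (suc (suc _)) _   (_ , ())
  pad-disjoint A⊥B 1 (suc (suc _)) _   (_ , ())

  ⋃-pad : ∀ {A B} → ⋃[ U ] (pad A B) ≐ A ∪ B
  ⋃-pad = (λ { (0 , _ , x∈A) → inj₁ x∈A ; (1 , _ , x∈B) → inj₂ x∈B })
        , [ (λ x∈A → 0 , _ , x∈A) , (λ x∈B → 1 , _ , x∈B) ]′

  -- At every level a Σ⁰ₙ set is a union over a c.e. index set, so merging the index sets is enough.
  -- The case split on n only makes `Σ⁰` unfold.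
  Σ⁰-union : ∀ n .{{_ : NonZero n}} i x → x ∈ Σ⁰ n (unionIndex i) ⇔ x ∈ ⋃[ W i ] (Σ⁰ n)
  Σ⁰-union n i x = mk⇔ (to′ n) (from′ n)
    where
    to′ : ∀ n .{{_ : NonZero n}} → x ∈ Σ⁰ n (unionIndex i) → x ∈ ⋃[ W i ] (Σ⁰ n)
    to′ 1 (l , l∈W , x∈) =
      let (j , j∈Wi , l∈Wj) = ∈-union⁻ l∈W in j , j∈Wi , l , l∈Wj , x∈
    to′ (suc (suc _)) (l , l∈W , x∈) =
      let (j , j∈Wi , l∈Wj) = ∈-union⁻ l∈W in j , j∈Wi , l , l∈Wj , x∈

    from′ : ∀ n .{{_ : NonZero n}} → x ∈ ⋃[ W i ] (Σ⁰ n) → x ∈ Σ⁰ n (unionIndex i)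
    from′ 1             (j , j∈Wi , l , l∈Wj , x∈) = l , ∈-union⁺ j∈Wi l∈Wj , x∈
    from′ (suc (suc _)) (j , j∈Wi , l , l∈Wj , x∈) = l , ∈-union⁺ j∈Wi l∈Wj , x∈

-- Additivity and null sets

module Recurrence (em : ExcludedMiddle 0ℓ) {c ℓ} (𝒳 : ComputableProbabilitySpace c ℓ) where
  open ComputableProbabilitySpace 𝒳
  open MetricSpaceProperties metricSpace
  open Setoid setoid using () renaming (refl to ≈-refl)

  ∖-borel : ∀ {A B} → Borel A → Borel B → Borel (A ∖ B)
  -- The difference is the complement of the union of ∁ A and B.
  ∖-borel {A} {B} a b = resp
    ( (λ x∉ → decidable-stable em (λ x∉A → x∉ (⊆⋃ (inj₁ x∉A))) , λ x∈B → x∉ (⊆⋃ (inj₂ x∈B)))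
    , λ (x∈A , x∉B) x∈⋃ → [ (λ x∉A → x∉A x∈A) , x∉B ]′ (⋃⊆ x∈⋃))
    (compl (union U (pad-borel (compl a) b)))
    where
    ⋃⊆ : ⋃[ U ] (pad (∁ A) B) ⊆ ∁ A ∪ B
    ⋃⊆ = proj₁ ⋃-pad

    ⊆⋃ : ∁ A ∪ B ⊆ ⋃[ U ] (pad (∁ A) B)
    ⊆⋃ = proj₂ ⋃-pad

  ⋂-borel : ∀ {A : ℕ → Pred X 0ℓ} → (∀ i → Borel (A i)) → Borel (λ x → ∀ i → x ∈ A i)
  ⋂-borel a = resp
    ( (λ x∉ i → decidable-stable em λ x∉Aᵢ → x∉ (i , _ , x∉Aᵢ))
    , λ x∈ (i , _ , x∉Aᵢ) → x∉Aᵢ (x∈ i))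
    (compl (union U (compl ∘ a)))

  Null : ∀ {A} → Borel A → Set
  Null a = μ a ≤ʳ 0ʳ

  -- Countable additivity for ∅, ∅, … gives μ(∅) + μ(∅) ≤ μ(∅).
  μ-∅ : Null ∅-borel
  μ-∅ = +ʳ-cancelʳ-≤ʳ em z 0ʳ z λ q∈z+z →
    x≤0+x z (proj₁ (μ-cong (union U λ _ → ∅-borel) ∅-borel ((λ ()) , λ ()))
      (HasSum-≥ (λ _ → z) (μ (union U λ _ → ∅-borel)) (z +ʳ z) 2 sums z+z≤sum q∈z+z))
    where
    z : ℝ
    z = μ ∅-borel

    sums : HasSum (λ _ → z) (μ (union U λ _ → ∅-borel))
    sums = μ-countablyAdditive (λ _ → ∅-borel) (λ _ _ _ ())

    z+z≤sum : ∀ n → z +ʳ z ≤ʳ sumʳ (λ _ → z) (2 + n)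
    z+z≤sum zero       = +ʳ-monoˡ-≤ʳ z z (0ʳ +ʳ z) (x≤0+x z)
    z+z≤sum (suc n) q∈ = +ʳ-monoʳ-≤ʳ w 0ʳ z (μ-nonNeg ∅-borel) (x≤x+0 w (z+z≤sum n q∈))
      where
      w : ℝ
      w = sumʳ (λ _ → z) (2 + n)

  -- Countable additivity for A, B, ∅, ∅, ...: from the second on, every partial sum equals μ(A) +
  -- μ(B), because ∅ is null.
  μ-∪ : ∀ {A B C} (a : Borel A) (b : Borel B) (c : Borel C) →
        A ⊥ B → C ≐ A ∪ B → μ c ≈ʳ μ a +ʳ μ b
  μ-∪ {A} {B} {C} a b c A⊥B (C⊆ , ⊆C) =
    (λ q∈ → HasSum-≤ u (μ (union U pieces)) (μ a +ʳ μ b) 2 sums sum≤ (proj₁ c≈⋃ q∈)) ,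
    (λ q∈ → proj₂ c≈⋃ (HasSum-≥ u (μ (union U pieces)) (μ a +ʳ μ b) 2 sums sum≥ q∈))
    where
    pieces : ∀ i → Borel (pad A B i)
    pieces = pad-borel a b

    u : ℕ → ℝ
    u i = μ (pieces i)

    sums : HasSum u (μ (union U pieces))
    sums = μ-countablyAdditive pieces (pad-disjoint A⊥B)

    c≈⋃ : μ c ≈ʳ μ (union U pieces)
    c≈⋃ = μ-cong c (union U pieces)
      ( (λ x∈C → proj₂ ⋃-pad (C⊆ x∈C))
      , (λ x∈⋃ → ⊆C (proj₁ ⋃-pad x∈⋃)))

    sum≤ : ∀ n → sumʳ u (2 + n) ≤ʳ μ a +ʳ μ b
    sum≤ zero       = +ʳ-monoˡ-≤ʳ (μ b) (0ʳ +ʳ μ a) (μ a) (0+x≤x (μ a))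
    sum≤ (suc n) q∈ = sum≤ n
      (x+0≤x (sumʳ u (2 + n)) (+ʳ-monoʳ-≤ʳ (sumʳ u (2 + n)) (μ ∅-borel) 0ʳ μ-∅ q∈))

    sum≥ : ∀ n → μ a +ʳ μ b ≤ʳ sumʳ u (2 + n)
    sum≥ zero       = +ʳ-monoˡ-≤ʳ (μ b) (μ a) (0ʳ +ʳ μ a) (x≤0+x (μ a))
    sum≥ (suc n) q∈ = +ʳ-monoʳ-≤ʳ (sumʳ u (2 + n)) 0ʳ (μ ∅-borel) (μ-nonNeg ∅-borel)
      (x≤x+0 (sumʳ u (2 + n)) (sum≥ n q∈))

  μ-∖ : ∀ {A B} (a : Borel A) (b : Borel B) → A ⊆ B → μ b ≈ʳ μ a +ʳ μ (∖-borel b a)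
  μ-∖ {A} {B} a b A⊆B = μ-∪ a (∖-borel b a) b (λ (x∈A , _ , x∉A) → x∉A x∈A)
    (cover , [ A⊆B , proj₁ ]′)
    where
    cover : B ⊆ A ∪ (B ∖ A)
    cover {x} x∈B with em {x ∈ A}
    ... | yes x∈A = inj₁ x∈A
    ... | no x∉A  = inj₂ (x∈B , x∉A)

  μ-mono : ∀ {A B} (a : Borel A) (b : Borel B) → A ⊆ B → μ a ≤ʳ μ b
  μ-mono a b A⊆B q∈ = proj₂ (μ-∖ a b A⊆B)
    (+ʳ-monoʳ-≤ʳ (μ a) 0ʳ (μ (∖-borel b a)) (μ-nonNeg (∖-borel b a)) (x≤x+0 (μ a) q∈))

  -- Measures are real numbers, hence finite, so μ(A) can be cancelled from the additivity equation.
  ∖-null : ∀ {A B} (a : Borel A) (b : Borel B) → A ⊆ B → μ b ≤ʳ μ a → Null (∖-borel b a)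
  ∖-null a b A⊆B b≤a = +ʳ-cancelˡ-≤ʳ em (μ (∖-borel b a)) 0ʳ (μ a)
    λ q∈ → x≤x+0 (μ a) (b≤a (proj₂ (μ-∖ a b A⊆B) q∈))

  null-from-∖ : ∀ {A B} (a : Borel A) (b : Borel B) → A ⊆ B → Null a → Null (∖-borel b a) → Null b
  null-from-∖ a b A⊆B a-null b∖a-null q∈ = x+0≤x 0ʳ
    (+ʳ-mono-≤ʳ {μ a} {0ʳ} {μ (∖-borel b a)} {0ʳ} a-null b∖a-null (proj₁ (μ-∖ a b A⊆B) q∈))

  ⋃-null : ∀ {A : ℕ → Pred X 0ℓ} (a : ∀ i → Borel (A i)) →
           (∀ i j → i ≢ j → A i ⊥ A j) → (∀ i → Null (a i)) → Null (union U a)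
  ⋃-null a disjoint null = HasSum-≤ u (μ (union U a)) 0ʳ 0 (μ-countablyAdditive a disjoint) sum≤0
    where
    u : ℕ → ℝ
    u i = μ (a i)

    sum≤0 : ∀ n → sumʳ u n ≤ʳ 0ʳ
    sum≤0 zero    q∈ = q∈
    sum≤0 (suc n) q∈ = x+0≤x 0ʳ (+ʳ-mono-≤ʳ {sumʳ u n} {0ʳ} {u n} {0ʳ} (sum≤0 n) (null n) q∈)

  null⇒≈0 : ∀ {A} (a : Borel A) → Null a → μ a ≈ʳ 0ʳ
  null⇒≈0 a null = null , μ-nonNeg a

  module _ {A : ℕ → Pred X 0ℓ} (a : ∀ i → Borel (A i))
           (decreasing : ∀ i → A (suc i) ⊆ A i) (preserved : ∀ i → μ (a i) ≤ʳ μ (a (suc i))) where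

    antitone : ∀ {i j} → i ≤′ j → A j ⊆ A i
    antitone ≤′-refl       = id
    antitone (≤′-step i≤j) = antitone i≤j ∘ decreasing _

    -- A point of `A 0` outside the intersection drops out between some `A i` and `A (suc i)`. These
    -- layers are disjoint, and null because the measure does not drop.
    ∖⋂-null : Null (∖-borel (a 0) (⋂-borel a))
    ∖⋂-null q∈ = ⋃-null layer-borel layers-disjoint layer-null
      (proj₁ (μ-cong (∖-borel (a 0) (⋂-borel a)) (union U layer-borel)
          (leaves-at-layer , layer⊆)) q∈)
      where
      layer : ℕ → Pred X 0ℓ
      layer i = A i ∖ A (suc i)

      layer-borel : ∀ i → Borel (layer i)
      layer-borel i = ∖-borel (a i) (a (suc i))

      layer-null : ∀ i → Null (layer-borel i)
      layer-null i = ∖-null (a (suc i)) (a i) (decreasing i) (preserved i)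

      layers-disjoint : ∀ i j → i ≢ j → layer i ⊥ layer j
      layers-disjoint i j i≢j ((x∈Aᵢ , x∉) , (x∈Aⱼ , x∉′)) with ℕₚ.<-cmp i j
      ... | tri< i<j _ _ = x∉ (antitone (ℕₚ.≤⇒≤′ i<j) x∈Aⱼ)
      ... | tri≈ _ i≡j _ = i≢j i≡j
      ... | tri> _ _ i>j = x∉′ (antitone (ℕₚ.≤⇒≤′ i>j) x∈Aᵢ)

      leaves-at-layer : A 0 ∖ (λ x → ∀ i → x ∈ A i) ⊆ ⋃[ U ] layer
      leaves-at-layer {x} (x∈A₀ , x∉⋂) = decidable-stable em λ none → x∉⋂ (everywhere none)
        where
        -- A point that lies in no layer stays in every `A i`, by induction.
        everywhere : ¬ (x ∈ ⋃[ U ] layer) → ∀ i → x ∈ A i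
        everywhere none zero    = x∈A₀
        everywhere none (suc i) = decidable-stable em λ x∉ →
          none (i , _ , everywhere none i , x∉)

      layer⊆ : ⋃[ U ] layer ⊆ A 0 ∖ (λ x → ∀ i → x ∈ A i)
      layer⊆ (i , _ , x∈Aᵢ , x∉) = antitone (ℕₚ.≤⇒≤′ z≤n) x∈Aᵢ , λ x∈⋂ → x∉ (x∈⋂ (suc i))

  -- Orbits and visiting times

  module _ (𝒯 : MeasurePreserving) where
    open MeasurePreserving 𝒯

    -- T depends on a proof of membership in `dom`; two proofs give equal points, which a Borel set
    -- does not separate.
    T-irrelevant : ∀ {A x} → Borel A → (p q : x ∈ dom) → T x p ∈ A → T x q ∈ A
    T-irrelevant a p q = borel-respects-≈ a (T-cong p q ≈-refl)

    preimage^ : ℕ → Pred X 0ℓ → Pred X 0ℓ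
    preimage^ zero    A = A
    preimage^ (suc k) A = preimage (preimage^ k A)

    preimage^-borel : ∀ k {A} → Borel A → Borel (preimage^ k A)
    preimage^-borel zero    a = a
    preimage^-borel (suc k) a = measurable (preimage^-borel k a)

    -- The numbers N + k are the times from N on. In this form raising N by one is definitionally
    -- one more preimage.
    hits : Pred X 0ℓ → ℕ → Pred X 0ℓ
    hits A N = ⋃[ U ] (λ k → preimage^ (N + k) A)

    hits-borel : ∀ {A} → Borel A → ∀ N → Borel (hits A N)
    hits-borel a N = union U λ k → preimage^-borel (N + k) a

    hits-decreasing : ∀ {A} N → hits A (suc N) ⊆ hits A N
    hits-decreasing {A} N {x} (k , _ , x∈) =
      suc k , _ , subst (λ m → x ∈ preimage^ m A) (sym (ℕₚ.+-suc N k)) x∈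

    preimage-hits : ∀ {A} N → hits A (suc N) ≐ preimage (hits A N)
    preimage-hits N =
      (λ (k , _ , p , Tx∈) → p , k , _ , Tx∈) , (λ (p , k , _ , Tx∈) → k , _ , p , Tx∈)

    -- `preimage^` peels off the first application of T and `iterate′` the last; `shift` reconciles
    -- the two.
    iterate-∈ : ∀ k {A x} → Borel A → (p : x ∈ dom) → x ∈ preimage^ k A → iterate k x p ∈ A
    iterate-∈ zero    a p x∈A = x∈A
    iterate-∈ (suc k) {A} {x} a p (q , Tx∈) = subst (λ y → proj₁ y ∈ A) (sym (shift k))
      (iterate-∈ k a (invariant x p) (T-irrelevant (preimage^-borel k a) q p Tx∈))
      where
      shift : ∀ k → iterate′ (suc k) (x , p) ≡ iterate′ k (T x p , invariant x p)
      shift zero    = refl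
      shift (suc k) = cong (λ (y , q) → T y q , invariant y q) (shift k)

    -- Effectivity of preimages

    module _ (T-computable : IsComputable) where

      -- Induction on n. At level 1 the indices of the preimages of the constituent balls are merged
      -- into one. Above that, preimages commute with complements inside `dom`, so it suffices to
      -- map the index set through the function for the level below.
      preimage-Σ⁰ : ∀ n .{{_ : NonZero n}} →
        ∃[ h ] Computable h × (∀ i x (p : x ∈ dom) → T x p ∈ Σ⁰ n i ⇔ x ∈ Σ⁰ n (h i))
      preimage-Σ⁰ 1 =
        let (f , f-computable , f-index) = T-computable
            (c , c⇓)                     = computable⇒code f-computable
        in unionIndex ∘ imageIndex c ,
           ∘-computable unionIndex-computable (imageIndex-computable c) ,
           λ i x p → mk⇔
             (λ (j , j∈W , Tx∈) → from (Σ⁰-union 1 (imageIndex c i) x)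
               (f j , ∈-image⁺ c⇓ j∈W , proj₂ (proj₁ (f-index j) (p , Tx∈))))
             (λ x∈ → fromUnion i p c⇓ f-index (to (Σ⁰-union 1 (imageIndex c i) x) x∈))
        where
        fromUnion : ∀ {f c} i {x} (p : x ∈ dom) → Computes c f →
          (∀ j → Σ⁰In 1 dom (preimage (B j)) (f j)) →
          x ∈ ⋃[ W (imageIndex c i) ] (Σ⁰ 1) → T x p ∈ Σ⁰ 1 i
        fromUnion i p c⇓ f-index (l , l∈W , x∈) with (j , j∈W , refl) ← ∈-image⁻ {i = i} c⇓ l∈W =
          -- The proof q that x lies in `dom` need not be p.
          let (q , Tx∈) = proj₂ (f-index j) (p , x∈)
          in j , j∈W , T-irrelevant (B-borel j) q p Tx∈
      preimage-Σ⁰ (suc (suc n)) =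
        let (h , h-computable , h-index) = preimage-Σ⁰ (suc n)
            (c , c⇓)                     = computable⇒code h-computable
        in imageIndex c , imageIndex-computable c ,
           λ i x p → mk⇔
             (λ (j , j∈W , Tx∉) → h j , ∈-image⁺ c⇓ j∈W , λ x∈ → Tx∉ (from (h-index j x p) x∈))
             (λ (l , l∈W , x∉) → let (j , j∈W , l≡) = ∈-image⁻ {i = i} c⇓ l∈W in
               j , j∈W , λ Tx∈ →
                 x∉ (subst (λ l → x ∈ Σ⁰ (suc n) l) (sym l≡) (to (h-index j x p) Tx∈)))

      -- The iterates of h on the index of A form a c.e. set of indices, one for each visiting time,
      -- and Σ⁰ₙ is closed under c.e. unions.
      hits-Σ⁰ : ∀ n .{{_ : NonZero n}} {A} → IsΣ⁰ n A →
        ∃[ e ] (∀ x → x ∈ dom → x ∈ Σ⁰ n e ⇔ x ∈ hits A 1)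
      hits-Σ⁰ n {A} (i , A⊆ , ⊆A) =
        let (h , h-computable , h-index) = preimage-Σ⁰ n
            -- Starting from `h i` rather than i makes stage k the preimage under k + 1 steps, so
            -- time 0 is left out.
            (e , e-range)                = range-index (iter-computable h-computable (h i))
        in unionIndex e , hits⇔ h-index e-range
        where
        module _ {h : ℕ → ℕ}
                 (h-index : ∀ i x (p : x ∈ dom) → T x p ∈ Σ⁰ n i ⇔ x ∈ Σ⁰ n (h i)) where

          stage : ∀ k x → x ∈ dom → x ∈ preimage^ (suc k) A ⇔ x ∈ Σ⁰ n (iter h (h i) k)
          stage zero x p = mk⇔
            (λ (q , Tx∈) → to (h-index i x q) (A⊆ Tx∈))
            (λ x∈ → p , ⊆A (from (h-index i x p) x∈))
          stage (suc k) x p = mk⇔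
            (λ (q , Tx∈) → to (h-index _ x q) (to (stage k (T x q) (invariant x q)) Tx∈))
            (λ x∈ → p , from (stage k (T x p) (invariant x p)) (from (h-index _ x p) x∈))

          hits⇔ : ∀ {e} → (∀ j → W e j ⇔ (∃[ k ] j ≡ iter h (h i) k)) →
                  ∀ x → x ∈ dom → x ∈ Σ⁰ n (unionIndex e) ⇔ x ∈ hits A 1
          hits⇔ {e} e-range x p = mk⇔
            (λ x∈ → let (j , j∈W , x∈Σj) = to (Σ⁰-union n e x) x∈
                        (k , j≡)         = to (e-range j) j∈W
                    in k , _ , from (stage k x p) (subst (λ j → x ∈ Σ⁰ n j) j≡ x∈Σj))
            (λ (k , _ , x∈) → from (Σ⁰-union n e x)
              (iter h (h i) k , from (e-range (iter h (h i) k)) (k , refl) , to (stage k x p) x∈))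

    -- The set E of recurrent points

    module _ {A : Pred X 0ℓ} (a : Borel A) where

      recurrent : Pred X 0ℓ
      recurrent x = ∀ N → x ∈ hits A N

      recurrent-borel : Borel recurrent
      recurrent-borel = ⋂-borel (hits-borel a)

      -- Applying T shifts all visiting times by one, which does not affect visits at arbitrarily
      -- late times.
      recurrent-invariant : preimage recurrent ≐ recurrent
      recurrent-invariant =
        (λ (p , Tx∈) N → hits-decreasing N (proj₂ (preimage-hits N) (p , Tx∈ N))) ,
        -- A visit at a time at least 1 already shows that x lies in `dom`.
        λ x∈ → let (p , _) = proj₁ (preimage-hits 0) (x∈ 1) in
          p , λ N → let (q , Tx∈) = proj₁ (preimage-hits N) (x∈ (suc N)) in
            T-irrelevant (hits-borel a N) q p Tx∈

      -- Each `hits A (suc N)` is the preimage of `hits A N`, so both have the same measure.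
      hits∖recurrent-null : Null (∖-borel (hits-borel a 0) recurrent-borel)
      hits∖recurrent-null = ∖⋂-null (hits-borel a) hits-decreasing λ N q∈ →
        proj₁ (μ-cong (measurable (hits-borel a N)) (hits-borel a (suc N))
          (proj₂ (preimage-hits N) , proj₁ (preimage-hits N)))
          (proj₂ (preserves (hits-borel a N)) q∈)

      -- Were E null, `hits A 0` would be null too, as it exceeds E by a null set; but it contains
      -- A.
      recurrent-full : Ergodic → 0ʳ <ʳ μ a → Null (compl recurrent-borel)
      recurrent-full ergodic 0<μA with ergodic recurrent-borel recurrent-invariant
      ... | inj₁ (null , _) = ⊥-elim (<ʳ⇒≱ʳ {0ʳ} {μ a} 0<μA A-null)
        where
        hits₀-null : Null (hits-borel a 0)
        hits₀-null = null-from-∖ recurrent-borel (hits-borel a 0) (λ x∈ → x∈ 0) null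
          hits∖recurrent-null

        A-null : Null a
        A-null q∈ = hits₀-null (μ-mono a (hits-borel a 0) (λ x∈A → 0 , _ , x∈A) q∈)
      ... | inj₂ (_ , full) = λ q∈ →
        ∖-null recurrent-borel U-borel _ (λ q∈U → full (proj₁ μ-total q∈U))
        (μ-mono (compl recurrent-borel) (∖-borel U-borel recurrent-borel) (λ x∉ → _ , x∉) q∈)

      recurrent⊆dom : recurrent ⊆ dom
      recurrent⊆dom x∈ = let (_ , _ , p , _) = x∈ 1 in p

      -- Outside `dom` nothing is known about `Σ⁰ n e`. This is harmless: E lies inside `dom`, so
      -- its points are in `Σ⁰ n e`, and the complement of the latter lies in the null complement of
      -- E.
      random-hits : ∀ n .{{_ : NonZero n}} e → (∀ x → x ∈ dom → x ∈ Σ⁰ n e ⇔ x ∈ hits A 1) →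
        Ergodic → 0ʳ <ʳ μ a → ∀ {x} → WeaklyRandom n x → x ∈ dom → x ∈ hits A 1
      random-hits n e e-index ergodic 0<μA {x} x-random x∈dom =
        to (e-index x x∈dom) (decidable-stable em
          (x-random {∁ (Σ⁰ n e)} (e , id , id) (null⇒≈0 ∁Σ⁰ ∁Σ⁰-null)))
        where
        ∁Σ⁰ : Borel (∁ (Σ⁰ n e))
        ∁Σ⁰ = IsΠ⁰⇒Borel n {∁ (Σ⁰ n e)} (e , id , id)

        ∁Σ⁰-null : Null ∁Σ⁰
        ∁Σ⁰-null q∈ = recurrent-full ergodic 0<μA
          (μ-mono ∁Σ⁰ (compl recurrent-borel)
            (λ {y} x∉ x∈ → x∉ (from (e-index y (recurrent⊆dom x∈)) (x∈ 1))) q∈)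

theorem2p3 : (∀ {a} → ExcludedMiddle a) →
    ∀ {c ℓ} (𝒳 : ComputableProbabilitySpace c ℓ) →
    let open ComputableProbabilitySpace 𝒳 in
    (n : ℕ) .{{_ : NonZero n}} (x : X) → WeaklyRandom n x →
    (A : Pred X 0ℓ) (Σ⁰A : IsΣ⁰ n A) → 0ʳ <ʳ μ (IsΣ⁰⇒Borel n Σ⁰A) →
    (𝒯 : MeasurePreserving) →
    let open MeasurePreserving 𝒯 in
    IsComputable → Ergodic → (x∈dom : x ∈ dom) →
    ∃[ k ] k > 0 × iterate k x x∈dom ∈ A
theorem2p3 em 𝒳 n x x-random A Σ⁰A 0<μA 𝒯 T-computable ergodic x∈dom =
  let (e , e-index) = hits-Σ⁰ 𝒯 T-computable n {A} Σ⁰A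
      (k , _ , x∈)  = random-hits 𝒯 a n e e-index ergodic 0<μA x-random x∈dom
  -- Membership in `hits A 1` is a visit at time 1 + k, which is positive.
  in suc k , z<s , iterate-∈ 𝒯 (suc k) a x∈dom x∈
  where
  open ComputableProbabilitySpace 𝒳
  open Recurrence em 𝒳

  a : Borel A
  a = IsΣ⁰⇒Borel n Σ⁰A
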